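{- Let $D$ be a decidable domain presented by a language $L$, let $L^{+}$ adjoin the parametrised gate $\mathrm{ask}(\cdot)$, and let $(a_k)_{k\in\mathbb{N}}$ be the iterates. If $Q(p)=\{p\}$, then $F_p$ is one of the four unary Boolean functions and the eventual period of $(a_k(p))_{k\in\mathbb{N}}$ is $1$ or $2$. It is $2$ exactly when $F_p$ is negation, that is, exactly when $p$ is a diagonal distinction.
   Context: A domain $D$ presented by a language $L$ with a computable numbering of its systems has a manifestation predicate; it is decidable if it is decidable whether a given system manifests. $L^{+}$ is obtained from $L$ by adjoining a gate $\mathrm{ask}(q)$ with a parameter $q\in\mathbb{N}$; $L^+$ is a decidable set of finite syntactic objects with a fixed computable numbering $\nu:\mathbb{N}\to L^{+}$ extending that of $L$. Assigning a value in $\{0,1\}=\{\text{void},\text{mark}\}$ to every occurring gate turns a system of $L^+$ into a gate-free system of $L$, which is evaluated as in $L$. Iterates: $a_0(p)=0$ for all $p$; $a_{k+1}(p)=1$ if the system $\nu(p)$, evaluated with each occurrence of $\mathrm{ask}(q)$ returning $a_k(q)$, fails to manifest, and $a_{k+1}(p)=0$ otherwise. $Q(p)=\{q:\mathrm{ask}(q)\text{ occurs in }\nu(p)\}$. $F_p:\{0,1\}^{Q(p)}\to\{0,1\}$ sends an assignment of gate values to $1$ if $\nu(p)$, evaluated with those gate values, fails to manifest, and to $0$ otherwise; so $a_{k+1}(p)=F_p(a_k\restriction Q(p))$. A $p$ with $Q(p)=\{p\}$ is a diagonal distinction if $\nu(p)$, evaluated with its gate $\mathrm{ask}(p)$ returning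 $b\in\{0,1\}$, manifests if and only if $b=1$. -}

module Defs where

open import Data.Bool.Base using (Bool; true; false; not)
open import Data.List.Base using (List; []; _∷_)
open import Data.List.Membership.Propositional using (_∈_)
open import Data.List.Relation.Unary.All as All using (All)
open import Data.Nat.Base using (ℕ; zero; suc; _+_; _≤_; _<_)
open import Data.Product.Base using (_×_; _,_; ∃-syntax; proj₂)
open import Function.Base using (const; id)
open import Function.Bundles using (_⇔_)
open import Function.Definitions using (StrictlySurjective)
open import Relation.Binary.Definitions using (DecidableEquality)
open import Relation.Binary.PropositionalEquality.Core using (_≡_; refl)
open import Relation.Nullary.Decidable.Core using (does; ¬?)
open import Relation.Unary using (Pred; Decidable; _≐_; ｛_｝)
open import Level using (0ℓ)

-- Computability of numberings and decision procedures is not a separate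
-- hypothesis: they are given as constructive functions.

record Language : Set₁ where
  field
    System       : Set
    μ            : ℕ → System
    μ-surjective : StrictlySurjective _≡_ μ

record Domain : Set₁ where
  field
    language : Language

  open Language language public

  field
    Manifests : Pred System 0ℓ

DecidableDomain : Domain → Set
DecidableDomain D = Decidable (Domain.Manifests D)

-- The extension L⁺ of a language L by the gates ask(q), q ∈ ℕ.  The decidable
-- set of L⁺-systems is represented by the discrete type of its elements.
record AskExtension (L : Language) : Set₁ where
  open Language L

  field
    System⁺ : Set
    _≟⁺_    : DecidableEquality System⁺

    -- The parameters q of the occurrences of gates ask(q), one list entry
    -- per occurrence.
    gates : System⁺ → List ℕ

    -- Replacing every gate occurrence by a value (false = 0 = void,
    -- true = 1 = mark) yields a system of L.
    fill : (s : System⁺) → All (const Bool) (gates s) → System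

    embed            : System → System⁺
    embed-gate-free  : ∀ x → gates (embed x) ≡ []
    fill-embed       : ∀ x v → fill (embed x) v ≡ x
    gate-free-system : ∀ s → gates s ≡ [] → ∃[ x ] embed x ≡ s

    -- ν extends the numbering μ of L: an index of a system of L is
    -- translated to an index of the same system in L⁺.
    ν            : ℕ → System⁺
    ν-surjective : StrictlySurjective _≡_ ν
    index        : ℕ → ℕ
    ν-extends-μ  : ∀ n → ν (index n) ≡ embed (μ n)

  -- {0,1}^{q : ask(q) occurs in s}.  Irrelevance of the membership proof makes
  -- the value depend on q only, not on which occurrence witnesses it.
  Assignment : System⁺ → Set
  Assignment s = (q : ℕ) → .(q ∈ gates s) → Bool

  assign : (s : System⁺) → Assignment s → System
  assign s α = fill s (All.tabulate λ {q} q∈ → α q q∈)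

  Q : ℕ → Pred ℕ 0ℓ
  Q p q = q ∈ gates (ν p)

module Iteration (D : Domain) (manifests? : DecidableDomain D)
                 (L⁺ : AskExtension (Domain.language D)) where
  open Domain D
  open AskExtension L⁺ public

  F : (p : ℕ) → Assignment (ν p) → Bool
  F p α = does (¬? (manifests? (assign (ν p) α)))

  a : ℕ → ℕ → Bool
  a zero    p = false
  a (suc k) p = does (¬? (manifests? (assign (ν p) λ q _ → a k q)))

  -- When Q(p) = {p}, evaluation at p identifies {0,1}^Q(p) with {0,1}; under
  -- this identification F p is the unary Boolean function f.
  F-is : (p : ℕ) → Q p ≐ ｛ p ｝ → (Bool → Bool) → Set
  F-is p Qp f = ∀ (α : Assignment (ν p)) → F p α ≡ f (α p (proj₂ Qp refl))

  -- As ask(p) is the only gate occurring in ν p, the constant assignment b is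
  -- the one in which ask(p) returns b.
  DiagonalDistinction : ℕ → Set
  DiagonalDistinction p =
    Q p ≐ ｛ p ｝ ×
    (∀ b → Manifests (assign (ν p) λ _ _ → b) ⇔ b ≡ true)

unaryBooleanFunctions : List (Bool → Bool)
unaryBooleanFunctions = const false ∷ const true ∷ id ∷ not ∷ []

EventuallyRepeats : {A : Set} → (ℕ → A) → ℕ → Set
EventuallyRepeats s d = ∃[ N ] (∀ k → N ≤ k → s (k + d) ≡ s k)

-- The eventual period is the least positive d with s (k + d) ≡ s k for all
-- sufficiently large k.
EventualPeriod : {A : Set} → (ℕ → A) → ℕ → Set
EventualPeriod s d =
  0 < d × EventuallyRepeats s d ×
  (∀ e → 0 < e → EventuallyRepeats s e → d ≤ e)

{-# OPTIONS --safe #-}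
-- When ask(p) is the only gate of ν(p), the sequence a_k(p) is an orbit of a
-- single map Bool → Bool.  Three of the four such maps are idempotent, so that
-- their orbits are constant from k = 1 on; negation is a fixed-point-free
-- involution, so that all its orbits have period 2.

module Submission where

open import Defs
open import Data.Bool.Base using (Bool; true; false; not)
open import Data.Bool.Properties using (not-involutive; not-¬)
open import Data.List.Base using (List; []; _∷_)
open import Data.List.Membership.Propositional using (_∈_)
open import Data.List.Relation.Unary.All as All using ()
open import Data.List.Relation.Unary.Any using (here; there)
open import Data.Nat.Base using (ℕ; suc; _+_; _≤_; z≤n; s≤s)
open import Data.Nat.Properties using (+-comm; ≤-refl)
open import Data.Product.Base using (_×_; _,_; ∃-syntax; proj₁; proj₂)
open import Data.Sum.Base as Sum using (_⊎_; inj₁; inj₂)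
open import Function.Base using (_∘_)
open import Function.Bundles using (_⇔_; mk⇔; Equivalence)
open import Function.Construct.Composition using (_⇔-∘_)
open import Function.Construct.Symmetry using (⇔-sym)
open import Level using (Level)
open import Relation.Binary.PropositionalEquality
  using (_≡_; refl; sym; trans; cong; cong₂; _≗_; module ≡-Reasoning)
open import Relation.Nullary.Decidable using (Dec; yes; no; does; ¬?)
open import Relation.Nullary.Negation using (¬_; contradiction)
open import Relation.Unary using (Pred; _≐_; ｛_｝)

private
  variable
    ℓ ℓ′ : Level

-- Assignments are functions, which agree here only pointwise. Tabulated along the finite list of
-- gates they become data, and there pointwise agreement gives the propositional equality that
-- `fill` respects.
tabulate-cong : {A : Set ℓ} {P : Pred A ℓ′} {xs : List A}
                {f g : ∀ {x} → x ∈ xs → P x} →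
                (∀ {x} (x∈xs : x ∈ xs) → f x∈xs ≡ g x∈xs) →
                All.tabulate {xs = xs} f ≡ All.tabulate g
tabulate-cong {xs = []}    f≡g = refl
tabulate-cong {xs = _ ∷ _} f≡g =
  cong₂ All._∷_ (f≡g (here refl)) (tabulate-cong (f≡g ∘ there))

unary-classification : (g : Bool → Bool) →
                       ∃[ f ] (f ∈ unaryBooleanFunctions × g ≗ f)
unary-classification g with g false in g0 | g true in g1
... | false | false = _ , here refl , λ { false → g0 ; true → g1 }
... | true  | true  = _ , there (here refl) , λ { false → g0 ; true → g1 }
... | false | true  = _ , there (there (here refl)) , λ { false → g0 ; true → g1 }
... | true  | false = _ , there (there (there (here refl))) , λ { false → g0 ; true → g1 }

unary-idempotent-or-not : ∀ {f} → f ∈ unaryBooleanFunctions →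
                          (∀ b → f (f b) ≡ f b) ⊎ f ≡ not
unary-idempotent-or-not (here refl)                         = inj₁ λ _ → refl
unary-idempotent-or-not (there (here refl))                 = inj₁ λ _ → refl
unary-idempotent-or-not (there (there (here refl)))         = inj₁ λ _ → refl
unary-idempotent-or-not (there (there (there (here refl)))) = inj₂ refl

module _ {A : Set} {s : ℕ → A} {f : A → A} (step : ∀ k → s (suc k) ≡ f (s k)) where

  idempotent⇒period-1 : (∀ x → f (f x) ≡ f x) → EventualPeriod s 1
  -- The threshold is 1 because `s 0` may lie outside the image of `f`; all later terms lie in it,
  -- and an idempotent map fixes its image. Minimality is immediate, since `0 < e` unfolds to
  -- `1 ≤ e`.
  idempotent⇒period-1 idem = s≤s z≤n , (1 , repeats) , λ _ 0<e _ → 0<e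
    where
    open ≡-Reasoning
    repeats : ∀ k → 1 ≤ k → s (k + 1) ≡ s k
    repeats (suc k) _ = begin
      s (suc k + 1)   ≡⟨ cong s (+-comm (suc k) 1) ⟩
      s (suc (suc k)) ≡⟨ step (suc k) ⟩
      f (s (suc k))   ≡⟨ cong f (step k) ⟩
      f (f (s k))     ≡⟨ idem (s k) ⟩
      f (s k)         ≡⟨ step k ⟨
      s (suc k)       ∎

  fixedPointFree-involution⇒period-2 :
    (∀ x → f (f x) ≡ x) → (∀ x → ¬ f x ≡ x) → EventualPeriod s 2
  fixedPointFree-involution⇒period-2 invol fpf =
    s≤s z≤n , (0 , λ k _ → repeats k) , least
    where
    open ≡-Reasoning
    repeats : ∀ k → s (k + 2) ≡ s k
    repeats k = begin
      s (k + 2)       ≡⟨ cong s (+-comm k 2) ⟩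
      s (suc (suc k)) ≡⟨ step (suc k) ⟩
      f (s (suc k))   ≡⟨ cong f (step k) ⟩
      f (f (s k))     ≡⟨ invol (s k) ⟩
      s k             ∎

    least : ∀ e → 1 ≤ e → EventuallyRepeats s e → 2 ≤ e
    -- Repetition with shift 1, taken at the threshold `N` itself, would make `s N` a fixed point of
    -- `f`.
    least 1 _ (N , rep) = contradiction
      (trans (sym (step N)) (trans (cong s (+-comm 1 N)) (rep N ≤-refl)))
      (fpf (s N))
    least (suc (suc _)) _ _ = s≤s (s≤s z≤n)

period-1⇒¬period-2 : {A : Set} {s : ℕ → A} →
                     EventualPeriod s 1 → ¬ EventualPeriod s 2
period-1⇒¬period-2 (0<1 , repeats , _) (_ , _ , least)
  with s≤s () ← least 1 0<1 repeats

-- The two negations cancel: both sides say that the decision `P?` has the truth value `b`. This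
-- links Boolean equations for `F` with the logical form of a diagonal distinction.
does-¬?≡not⇔ : {P : Set ℓ} (P? : Dec P) (b : Bool) →
               does (¬? P?) ≡ not b ⇔ (P ⇔ b ≡ true)
does-¬?≡not⇔ (yes p) true  = mk⇔ (λ _ → mk⇔ (λ _ → refl) (λ _ → p)) (λ _ → refl)
does-¬?≡not⇔ (yes p) false = mk⇔ (λ ()) (λ P⇔ → Equivalence.to P⇔ p)
does-¬?≡not⇔ (no ¬p) true  =
  mk⇔ (λ ()) (λ P⇔ → contradiction (Equivalence.from P⇔ refl) ¬p)
does-¬?≡not⇔ (no ¬p) false =
  mk⇔ (λ _ → mk⇔ (λ p → contradiction p ¬p) (λ ())) (λ _ → refl)

module _ (D : Domain) (manifests? : DecidableDomain D)
         (L⁺ : AskExtension (Domain.language D)) where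
  open Iteration D manifests? L⁺

  F-cong : ∀ p {α β : Assignment (ν p)} →
           (∀ q (q∈ : Q p q) → α q q∈ ≡ β q q∈) → F p α ≡ F p β
  F-cong p α≡β =
    cong (λ v → does (¬? (manifests? (fill (ν p) v))))
         (tabulate-cong λ {q} → α≡β q)

  module _ (p : ℕ) (Qp : Q p ≐ ｛ p ｝) where

    unaryF : Bool → Bool
    unaryF b = F p (λ _ _ → b)

    -- Every gate that occurs is `p`, so `α` agrees on all occurring gates with the constant
    -- assignment of its value at `p`.
    F-is-unaryF : F-is p Qp unaryF
    F-is-unaryF α = F-cong p λ q q∈ → at (proj₁ Qp q∈) q∈
      where
      at : ∀ {q} → p ≡ q → .(q∈ : Q p q) → α q q∈ ≡ α p (proj₂ Qp refl)
      -- Once `q` is identified with `p`, the two sides differ only in an irrelevant membership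
      -- proof and so coincide definitionally.
      at refl _ = refl

    F-is⇔≗ : ∀ {f} → F-is p Qp f ⇔ unaryF ≗ f
    F-is⇔≗ = mk⇔ (λ F-is-f b → F-is-f (λ _ _ → b))
                 (λ g≗f α → trans (F-is-unaryF α) (g≗f _))

    -- By definition `a (suc k) p` is `F p` at the assignment given by all the `a k q`; only its
    -- value at `p` matters, so the recursion closes up on the single index `p`.
    a-step : ∀ {f} → unaryF ≗ f → ∀ k → a (suc k) p ≡ f (a k p)
    a-step g≗f k = Equivalence.from F-is⇔≗ g≗f (λ q _ → a k q)

    not⇒period-2 : unaryF ≗ not → EventualPeriod (λ k → a k p) 2
    not⇒period-2 g≗not = fixedPointFree-involution⇒period-2
      (a-step g≗not) not-involutive (λ _ eq → not-¬ refl (sym eq))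

    period-1-or-not : EventualPeriod (λ k → a k p) 1 ⊎ unaryF ≗ not
    period-1-or-not with f , f∈ , g≗f ← unary-classification unaryF
      with unary-idempotent-or-not f∈
    ... | inj₁ idem = inj₁ (idempotent⇒period-1 (a-step g≗f) idem)
    ... | inj₂ refl = inj₂ g≗f

    -- If `unaryF` is not negation, the dichotomy leaves period 1, and minimality excludes having
    -- both periods.
    period-2⇒not : EventualPeriod (λ k → a k p) 2 → unaryF ≗ not
    period-2⇒not per2 with period-1-or-not
    ... | inj₁ per1  = contradiction per2 (period-1⇒¬period-2 per1)
    ... | inj₂ g≗not = g≗not

    not⇔diagonal : unaryF ≗ not ⇔ DiagonalDistinction p
    not⇔diagonal = mk⇔
      (λ g≗not → Qp , λ b → Equivalence.to (does-¬?≡not⇔ (manifests? _) b) (g≗not b))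
      (λ diag b → Equivalence.from (does-¬?≡not⇔ (manifests? _) b) (proj₂ diag b))

corollary5p4 : (D : Domain) (manifests? : DecidableDomain D)
    (L⁺ : AskExtension (Domain.language D)) →
    let open Iteration D manifests? L⁺ in
    ∀ p (Qp : Q p ≐ ｛ p ｝) →
    (∃[ f ] (f ∈ unaryBooleanFunctions × F-is p Qp f))
    × (EventualPeriod (λ k → a k p) 1 ⊎ EventualPeriod (λ k → a k p) 2)
    × (EventualPeriod (λ k → a k p) 2 ⇔ F-is p Qp not)
    × (F-is p Qp not ⇔ DiagonalDistinction p)
corollary5p4 D manifests? L⁺ p Qp
  with f , f∈ , g≗f ← unary-classification (unaryF D manifests? L⁺ p Qp) =
    (f , f∈ , from F⇔ g≗f)
  , Sum.map₂ (not⇒period-2 D manifests? L⁺ p Qp) (period-1-or-not D manifests? L⁺ p Qp)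
  , ⇔-sym F⇔ ⇔-∘ mk⇔ (period-2⇒not D manifests? L⁺ p Qp) (not⇒period-2 D manifests? L⁺ p Qp)
  , not⇔diagonal D manifests? L⁺ p Qp ⇔-∘ F⇔
  where
  open Equivalence
  F⇔ : ∀ {f} → Iteration.F-is D manifests? L⁺ p Qp f ⇔ unaryF D manifests? L⁺ p Qp ≗ f
  F⇔ = F-is⇔≗ D manifests? L⁺ p Qp
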